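{- For any program $N$ we have $\mathcal M[\![N]\!]=\mathcal M[\![\mathrm{Op}(N)]\!]$.
   Context: **Syntax.** Fix a set of base types $b$ (including $\mathtt{Bool}$); constants $c:b$ of base types (including $\mathtt{tt},\mathtt{ff}:\mathtt{Bool}$); function symbols $f:b_1\ldots b_m\to b$ (including $=_b\,:b\,b\to\mathtt{Bool}$ for each $b$); and algebraic operation symbols $op:b_1\ldots b_n;m$ (parameter base types $b_1,\dots,b_n$, arity $m\in\mathbb N$). Types: $\sigma::=b\mid\mathtt{Unit}\mid\sigma\times\sigma\mid\sigma\to\sigma$. Terms: $M::=x\mid c\mid f(M_1,\dots,M_m)\mid\mathtt{if}\,L\,\mathtt{then}\,M\,\mathtt{else}\,N\mid op(N_1,\dots,N_n;M_1,\dots,M_m)\mid *\mid\langle M,N\rangle\mid\mathtt{fst}(M)\mid\mathtt{snd}(M)\mid\lambda x{:}\sigma.M\mid MN$, up to $\alpha$-equivalence, with standard simple typing; $op(N_1,\dots,N_n;M_1,\dots,M_m)$ has type $\sigma$ when $N_j:b_j$ and all $M_i:\sigma$. Programs are closed well-typed terms. **Operational semantics.** Values: $V::=c\mid *\mid\langle V,W\rangle\mid\lambda x{:}\sigma.M$ (closed). Effect values: $E::=V\mid op(c_1,\dots,c_n;E_1,\dots,E_m)$. Evaluation contexts (closed): $\mathcal E::=[\,]\mid f(c_1,\dots,c_{k-1},\mathcal E,M_{k+1},\dots,M_m)\mid\mathtt{if}\,\mathcal E\,\mathtt{then}\,M\,\mathtt{else}\,N\mid op(c_1,\dots,c_{k-1},\mathcal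 E,N_{k+1},\dots,N_n;M_1,\dots,M_m)\mid\langle\mathcal E,N\rangle\mid\langle V,\mathcal E\rangle\mid\mathtt{fst}(\mathcal E)\mid\mathtt{snd}(\mathcal E)\mid\mathcal E N\mid(\lambda x{:}\sigma.M)\mathcal E$. For each $f:b_1\ldots b_m\to b$ and constants $c_i:b_i$ a constant $\mathrm{val}_f(c_1,\dots,c_m):b$ is given, with $\mathrm{val}_{=_b}(c,c')=\mathtt{tt}$ if $c=c'$ and $\mathtt{ff}$ otherwise. Ordinary steps $\mathcal E[Q]\to\mathcal E[Q']$ arise from $f(c_1,\dots,c_m)\to\mathrm{val}_f(c_1,\dots,c_m)$; $\mathtt{if}\,\mathtt{tt}\,\mathtt{then}\,M\,\mathtt{else}\,N\to M$; $\mathtt{if}\,\mathtt{ff}\,\mathtt{then}\,M\,\mathtt{else}\,N\to N$; $\mathtt{fst}\langle V,W\rangle\to V$; $\mathtt{snd}\langle V,W\rangle\to W$; $(\lambda x{:}\sigma.M)V\to M[V/x]$. Each program is exactly one of: a value; a program with a unique ordinary step; or uniquely of the form $\mathcal E[op(c_1,\dots,c_n;M_1,\dots,M_m)]$; all transition sequences (where in the last case one passes to any $\mathcal E[M_i]$) terminate. The effect value $\mathrm{Op}(M)$ of a program is thus determined by: $\mathrm{Op}(V)=V$; $\mathrm{Op}(M)=\mathrm{Op}(M')$ if $M\to M'$; $\mathrm{Op}(\mathcal E[op(c_1,\dots,c_n;M_1,\dots,M_m)])=op(c_1,\dots,c_n;\mathrm{Op}(\mathcal E[M_1]),\dots,\mathrm{Op}(\mathcal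 E[M_m]))$. **Denotational semantics.** Given are: a (necessarily strong) monad $\mathcal{T}$ on sets (unit $\eta$, Kleisli extension $(-)^\dagger$); nonempty sets $[\![b]\!]$ with $[\![\mathtt{Bool}]\!]=\{0,1\}$; elements $[\![c]\!]\in[\![b]\!]$ for $c:b$, with $[\![\mathtt{tt}]\!]=1$, $[\![\mathtt{ff}]\!]=0$ and distinct constants of the same type having distinct denotations; functions $[\![f]\!]:[\![b_1]\!]\times\cdots\times[\![b_m]\!]\to[\![b]\!]$ with $[\![f]\!]([\![c_1]\!],\dots,[\![c_m]\!])=[\![\mathrm{val}_f(c_1,\dots,c_m)]\!]$; and generic effects $g_{op}:[\![b_1]\!]\times\cdots\times[\![b_n]\!]\to\mathcal T(\{0,\dots,m-1\})$ for each $op:b_1\ldots b_n;m$. The latter induce operations $op_X(o,(u_0,\dots,u_{m-1}))=(i\mapsto u_i)^\dagger(g_{op}(o))$ on $\mathcal T(X)$. Types denote: $\mathcal M[\![b]\!]=[\![b]\!]$, $\mathcal M[\![\mathtt{Unit}]\!]=\{*\}$, $\mathcal M[\![\sigma\times\tau]\!]=\mathcal M[\![\sigma]\!]\times\mathcal M[\![\tau]\!]$, $\mathcal M[\![\sigma\to\tau]\!]=\mathcal M[\![\sigma]\!]\to\mathcal T(\mathcal M[\![\tau]\!])$. A term $\Gamma\vdash M:\sigma$ denotes a function $\mathcal M[\![M]\!]:\mathcal M[\![\Gamma]\!]\to\mathcal T(\mathcal M[\![\sigma]\!])$ by the standard left-to-right call-by-value monadic semantics: $\mathcal M[\![x]\!](\rho)=\eta(\rho(x))$,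 $\mathcal M[\![c]\!](\rho)=\eta([\![c]\!])$, $\mathcal M[\![*]\!](\rho)=\eta(*)$, $\mathcal M[\![\lambda x{:}\sigma.M]\!](\rho)=\eta(a\mapsto\mathcal M[\![M]\!](\rho,a))$; pairs, projections, applications and function-symbol applications sequence their arguments left to right by Kleisli extension and then apply the evident function (for $f$, the function $[\![f]\!]$ followed by $\eta$); conditionals sequence the condition and then branch; and $\mathcal M[\![op(N_1,\dots,N_n;M_1,\dots,M_m)]\!](\rho)$ sequences $\mathcal M[\![N_1]\!](\rho),\dots,\mathcal M[\![N_n]\!](\rho)$ left to right to obtain parameters $o$ and then returns $op_X(o,(\mathcal M[\![M_1]\!](\rho),\dots,\mathcal M[\![M_m]\!](\rho)))$ with $X=\mathcal M[\![\sigma]\!]$. -}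

module Defs where

open import Data.Bool.Base as 𝔹 using (true; false)
open import Data.Fin.Base using (Fin; zero; suc)
open import Data.List.Base using (List; []; _∷_)
open import Data.List.Membership.Propositional using (_∈_)
open import Data.List.Relation.Unary.All as All using (All; []; _∷_)
open import Data.List.Relation.Unary.Any using (here; there)
open import Data.Nat.Base using (ℕ)
open import Data.Product.Base using (Σ; ∃-syntax; _×_; _,_; proj₁; proj₂)
open import Data.Unit.Base using (⊤; tt)
open import Data.Vec.Base as Vec using (Vec; []; _∷_)
import Data.Vec.Properties as Vec
import Data.Vec.Relation.Binary.Pointwise.Extensional as PW
open import Function.Base using (_∘_)
open import Relation.Binary.PropositionalEquality
  using (_≡_; _≢_; refl; sym; trans; cong; cong₂; subst)

data Base (Sort : Set) : Set where
  bool : Base Sort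
  sort : Sort → Base Sort

-- The only Boolean constants are tt and ff: distinct constants have
-- distinct denotations and Bool denotes {0,1}, so no others are possible.
-- (Otherwise a conditional on another constant would be stuck.)

data Constant {Sort : Set} (ConstSym : Sort → Set) : Base Sort → Set where
  tt ff : Constant ConstSym bool
  con   : ∀ {s} → ConstSym s → Constant ConstSym (sort s)

record Signature : Set₁ where
  field
    Sort     : Set
    ConstSym : Sort → Set
    FunSym   : List (Base Sort) → Base Sort → Set
    OpSym    : List (Base Sort) → ℕ → Set

  Const : Base Sort → Set
  Const = Constant ConstSym

  field
    eq     : ∀ b → FunSym (b ∷ b ∷ []) bool
    val    : ∀ {bs b} → FunSym bs b → All Const bs → Const b
    val-≡  : ∀ {b} (c c′ : Const b) → c ≡ c′ → val (eq b) (c ∷ c′ ∷ []) ≡ tt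
    val-≢  : ∀ {b} (c c′ : Const b) → c ≢ c′ → val (eq b) (c ∷ c′ ∷ []) ≡ ff

-- A monad on sets as a Kleisli triple.  The laws are pointwise; theorems
-- that need functions to be extensional, as they are between sets, must
-- assume function extensionality.

record Monad : Set₁ where
  infix 10 _†
  field
    T   : Set → Set
    η   : ∀ {X} → X → T X
    _†  : ∀ {X Y} → (X → T Y) → T X → T Y

    η-† : ∀ {X Y} (f : X → T Y) x → (f †) (η x) ≡ f x
    †-η : ∀ {X} (t : T X) → (η †) t ≡ t
    †-† : ∀ {X Y Z} (f : X → T Y) (g : Y → T Z) t →
          (g †) ((f †) t) ≡ (((g †) ∘ f) †) t

module Language (S : Signature) where
  open Signature S

  infixr 6 _⊗_
  infixr 5 _⇒_

  data Ty : Set where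
    base : Base Sort → Ty
    unit : Ty
    _⊗_  : Ty → Ty → Ty
    _⇒_  : Ty → Ty → Ty

  Ctx : Set
  Ctx = List Ty

  data Term (Γ : Ctx) : Ty → Set

  Args : Ctx → List (Base Sort) → Set
  Args Γ = All (λ b → Term Γ (base b))

  data Term Γ where
    var   : ∀ {σ} → σ ∈ Γ → Term Γ σ
    const : ∀ {b} → Const b → Term Γ (base b)
    fun   : ∀ {bs b} → FunSym bs b → Args Γ bs → Term Γ (base b)
    cond  : ∀ {σ} → Term Γ (base bool) → Term Γ σ → Term Γ σ → Term Γ σ
    op    : ∀ {bs m σ} → OpSym bs m → Args Γ bs → Vec (Term Γ σ) m → Term Γ σ
    ⋆     : Term Γ unit
    pair  : ∀ {σ τ} → Term Γ σ → Term Γ τ → Term Γ (σ ⊗ τ)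
    fst   : ∀ {σ τ} → Term Γ (σ ⊗ τ) → Term Γ σ
    snd   : ∀ {σ τ} → Term Γ (σ ⊗ τ) → Term Γ τ
    lam   : ∀ {σ τ} → Term (σ ∷ Γ) τ → Term Γ (σ ⇒ τ)
    app   : ∀ {σ τ} → Term Γ (σ ⇒ τ) → Term Γ σ → Term Γ τ

  Program : Ty → Set
  Program = Term []

  consts : ∀ {Γ bs} → All Const bs → Args Γ bs
  consts = All.map const

  Ren Sub : Ctx → Ctx → Set
  Ren Γ Δ = ∀ {σ} → σ ∈ Γ → σ ∈ Δ
  Sub Γ Δ = ∀ {σ} → σ ∈ Γ → Term Δ σ

  liftᴿ : ∀ {Γ Δ σ} → Ren Γ Δ → Ren (σ ∷ Γ) (σ ∷ Δ)
  liftᴿ r (here p)  = here p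
  liftᴿ r (there x) = there (r x)

  mutual
    ren : ∀ {Γ Δ σ} → Ren Γ Δ → Term Γ σ → Term Δ σ
    ren r (var x)       = var (r x)
    ren r (const c)     = const c
    ren r (fun f Ms)    = fun f (ren* r Ms)
    ren r (cond L M N)  = cond (ren r L) (ren r M) (ren r N)
    ren r (op o Ns Ms)  = op o (ren* r Ns) (renᵛ r Ms)
    ren r ⋆             = ⋆
    ren r (pair M N)    = pair (ren r M) (ren r N)
    ren r (fst M)       = fst (ren r M)
    ren r (snd M)       = snd (ren r M)
    ren r (lam M)       = lam (ren (liftᴿ r) M)
    ren r (app M N)     = app (ren r M) (ren r N)

    ren* : ∀ {Γ Δ bs} → Ren Γ Δ → Args Γ bs → Args Δ bs
    ren* r []       = []
    ren* r (M ∷ Ms) = ren r M ∷ ren* r Ms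

    renᵛ : ∀ {Γ Δ σ m} → Ren Γ Δ → Vec (Term Γ σ) m → Vec (Term Δ σ) m
    renᵛ r []       = []
    renᵛ r (M ∷ Ms) = ren r M ∷ renᵛ r Ms

  liftˢ : ∀ {Γ Δ σ} → Sub Γ Δ → Sub (σ ∷ Γ) (σ ∷ Δ)
  liftˢ s (here p)  = var (here p)
  liftˢ s (there x) = ren there (s x)

  mutual
    sub : ∀ {Γ Δ σ} → Sub Γ Δ → Term Γ σ → Term Δ σ
    sub s (var x)       = s x
    sub s (const c)     = const c
    sub s (fun f Ms)    = fun f (sub* s Ms)
    sub s (cond L M N)  = cond (sub s L) (sub s M) (sub s N)
    sub s (op o Ns Ms)  = op o (sub* s Ns) (subᵛ s Ms)
    sub s ⋆             = ⋆
    sub s (pair M N)    = pair (sub s M) (sub s N)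
    sub s (fst M)       = fst (sub s M)
    sub s (snd M)       = snd (sub s M)
    sub s (lam M)       = lam (sub (liftˢ s) M)
    sub s (app M N)     = app (sub s M) (sub s N)

    sub* : ∀ {Γ Δ bs} → Sub Γ Δ → Args Γ bs → Args Δ bs
    sub* s []       = []
    sub* s (M ∷ Ms) = sub s M ∷ sub* s Ms

    subᵛ : ∀ {Γ Δ σ m} → Sub Γ Δ → Vec (Term Γ σ) m → Vec (Term Δ σ) m
    subᵛ s []       = []
    subᵛ s (M ∷ Ms) = sub s M ∷ subᵛ s Ms

  _▸_ : ∀ {Γ Δ σ} → Sub Γ Δ → Term Δ σ → Sub (σ ∷ Γ) Δ
  (s ▸ V) (here refl) = V
  (s ▸ V) (there x)   = s x

  _[_] : ∀ {Γ σ τ} → Term (σ ∷ Γ) τ → Term Γ σ → Term Γ τ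
  M [ V ] = sub (var ▸ V) M

  data Value : ∀ {σ} → Program σ → Set where
    const : ∀ {b} (c : Const b) → Value (const c)
    ⋆     : Value ⋆
    pair  : ∀ {σ τ} {V : Program σ} {W : Program τ} →
            Value V → Value W → Value (pair V W)
    lam   : ∀ {σ τ} (M : Term (σ ∷ []) τ) → Value (lam M)

  data EffectValue {σ} : Program σ → Set where
    value : ∀ {V} → Value V → EffectValue V
    op    : ∀ {bs m} (o : OpSym bs m) (cs : All Const bs) {Es : Vec _ m} →
            (∀ i → EffectValue (Vec.lookup Es i)) →
            EffectValue (op o (consts cs) Es)

  -- Evaluation contexts with a hole of type ρ.  ArgsECtx is an argument
  -- list c₁,…,cₖ₋₁,ℰ,Mₖ₊₁,…,Mₙ.

  mutual
    data ECtx (ρ : Ty) : Ty → Set where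
      ∙     : ECtx ρ ρ
      fun   : ∀ {bs b} → FunSym bs b → ArgsECtx ρ bs → ECtx ρ (base b)
      cond  : ∀ {σ} → ECtx ρ (base bool) → Program σ → Program σ → ECtx ρ σ
      op    : ∀ {bs m σ} → OpSym bs m → ArgsECtx ρ bs → Vec (Program σ) m →
              ECtx ρ σ
      pairˡ : ∀ {σ τ} → ECtx ρ σ → Program τ → ECtx ρ (σ ⊗ τ)
      pairʳ : ∀ {σ τ} {V : Program σ} → Value V → ECtx ρ τ → ECtx ρ (σ ⊗ τ)
      fst   : ∀ {σ τ} → ECtx ρ (σ ⊗ τ) → ECtx ρ σ
      snd   : ∀ {σ τ} → ECtx ρ (σ ⊗ τ) → ECtx ρ τ
      appˡ  : ∀ {σ τ} → ECtx ρ (σ ⇒ τ) → Program σ → ECtx ρ τ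
      appʳ  : ∀ {σ τ} → Term (σ ∷ []) τ → ECtx ρ σ → ECtx ρ τ

    data ArgsECtx (ρ : Ty) : List (Base Sort) → Set where
      hole : ∀ {b bs} → ECtx ρ (base b) → Args [] bs → ArgsECtx ρ (b ∷ bs)
      skip : ∀ {b bs} → Const b → ArgsECtx ρ bs → ArgsECtx ρ (b ∷ bs)

  mutual
    plug : ∀ {ρ σ} → ECtx ρ σ → Program ρ → Program σ
    plug ∙                   Q = Q
    plug (fun f A)           Q = fun f (plug* A Q)
    plug (cond E M N)        Q = cond (plug E Q) M N
    plug (op o A Ms)         Q = op o (plug* A Q) Ms
    plug (pairˡ E N)         Q = pair (plug E Q) N
    plug (pairʳ {V = V} _ E) Q = pair V (plug E Q)
    plug (fst E)             Q = fst (plug E Q)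
    plug (snd E)             Q = snd (plug E Q)
    plug (appˡ E N)          Q = app (plug E Q) N
    plug (appʳ M E)          Q = app (lam M) (plug E Q)

    plug* : ∀ {ρ bs} → ArgsECtx ρ bs → Program ρ → Args [] bs
    plug* (hole E Ms) Q = plug E Q ∷ Ms
    plug* (skip c A)  Q = const c ∷ plug* A Q

  infix 4 _↦_ _⟶_ _⇓_

  data _↦_ : ∀ {σ} → Program σ → Program σ → Set where
    fun     : ∀ {bs b} (f : FunSym bs b) (cs : All Const bs) →
              fun f (consts cs) ↦ const (val f cs)
    cond-tt : ∀ {σ} {M N : Program σ} → cond (const tt) M N ↦ M
    cond-ff : ∀ {σ} {M N : Program σ} → cond (const ff) M N ↦ N
    fst     : ∀ {σ τ} {V : Program σ} {W : Program τ} → Value V → Value W →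
              fst (pair V W) ↦ V
    snd     : ∀ {σ τ} {V : Program σ} {W : Program τ} → Value V → Value W →
              snd (pair V W) ↦ W
    β       : ∀ {σ τ} (M : Term (σ ∷ []) τ) {V : Program σ} → Value V →
              app (lam M) V ↦ M [ V ]

  data _⟶_ {σ} : Program σ → Program σ → Set where
    within : ∀ {ρ} (E : ECtx ρ σ) {Q Q′ : Program ρ} → Q ↦ Q′ →
             plug E Q ⟶ plug E Q′

  -- M ⇓ E is the graph of Op, one constructor per defining clause.  It is
  -- shown below to be single-valued and total, which makes Op a function.

  data _⇓_ {σ} : Program σ → Program σ → Set where
    value : ∀ {V} → Value V → V ⇓ V
    step  : ∀ {M M′ E} → M ⟶ M′ → M′ ⇓ E → M ⇓ E
    op    : ∀ {ρ bs m} (ℰ : ECtx ρ σ) (o : OpSym bs m) (cs : All Const bs)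
            (Ms : Vec (Program ρ) m) (Es : Vec (Program σ) m) →
            (∀ i → plug ℰ (Vec.lookup Ms i) ⇓ Vec.lookup Es i) →
            plug ℰ (op o (consts cs) Ms) ⇓ op o (consts cs) Es

  ⇓-effectValue : ∀ {σ} {M E : Program σ} → M ⇓ E → EffectValue E
  ⇓-effectValue (value v)            = value v
  ⇓-effectValue (step _ d)           = ⇓-effectValue d
  ⇓-effectValue (op ℰ o cs Ms Es ds) = op o cs (λ i → ⇓-effectValue (ds i))

  -- The unique clause of _⇓_ that applies to a program.

  data Next {σ} (M : Program σ) : Set where
    value : Value M → Next M
    step  : Program σ → Next M
    op    : ∀ {bs m} → OpSym bs m → All Const bs → Vec (Program σ) m → Next M

  data Next* {bs} (Ms : Args [] bs) : Set where
    value : All Const bs → Next* Ms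
    step  : Args [] bs → Next* Ms
    op    : ∀ {bs′ m} → OpSym bs′ m → All Const bs′ → Vec (Args [] bs) m →
            Next* Ms

  private
    next-∷ : ∀ {b bs} {M : Program (base b)} {Ms : Args [] bs} →
             Next M → Next* Ms → Next* (M ∷ Ms)
    next-∷ {Ms = Ms} (step M′)     _ = step (M′ ∷ Ms)
    next-∷ {Ms = Ms} (op o cs M′s) _ = op o cs (Vec.map (_∷ Ms) M′s)
    next-∷ (value (const c)) (value cs)     = value (c ∷ cs)
    next-∷ (value (const c)) (step Ms′)     = step (const c ∷ Ms′)
    next-∷ (value (const c)) (op o cs Ms′s) =
      op o cs (Vec.map (const c ∷_) Ms′s)

    next-fun : ∀ {bs b} (f : FunSym bs b) {Ms : Args [] bs} →
               Next* Ms → Next (fun f Ms)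
    next-fun f (value cs)     = step (const (val f cs))
    next-fun f (step Ms′)     = step (fun f Ms′)
    next-fun f (op o cs Ms′s) = op o cs (Vec.map (fun f) Ms′s)

    next-op : ∀ {bs m σ} (o : OpSym bs m) {Ns : Args [] bs}
              (Ms : Vec (Program σ) m) → Next* Ns → Next (op o Ns Ms)
    next-op o Ms (value cs)       = op o cs Ms
    next-op o Ms (step Ns′)       = step (op o Ns′ Ms)
    next-op o Ms (op o′ cs Ns′s)  =
      op o′ cs (Vec.map (λ Ns → op o Ns Ms) Ns′s)

    next-cond : ∀ {σ L} (M N : Program σ) → Next L → Next (cond L M N)
    next-cond M N (value (const tt)) = step M
    next-cond M N (value (const ff)) = step N
    next-cond M N (step L′)          = step (cond L′ M N)
    next-cond M N (op o cs L′s)      =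
      op o cs (Vec.map (λ L → cond L M N) L′s)

    next-pair : ∀ {σ τ} {M : Program σ} {N : Program τ} →
                Next M → Next N → Next (pair M N)
    next-pair (value v) (value w)            = value (pair v w)
    next-pair {M = M} (value v) (step N′)    = step (pair M N′)
    next-pair {M = M} (value v) (op o cs Ns) =
      op o cs (Vec.map (pair M) Ns)
    next-pair {N = N} (step M′) _            = step (pair M′ N)
    next-pair {N = N} (op o cs Ms) _         =
      op o cs (Vec.map (λ M → pair M N) Ms)

    next-fst : ∀ {σ τ} {M : Program (σ ⊗ τ)} → Next M → Next (fst M)
    next-fst (value (pair {V = V} _ _)) = step V
    next-fst (step M′)                  = step (fst M′)
    next-fst (op o cs Ms)               = op o cs (Vec.map fst Ms)

    next-snd : ∀ {σ τ} {M : Program (σ ⊗ τ)} → Next M → Next (snd M)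
    next-snd (value (pair {W = W} _ _)) = step W
    next-snd (step M′)                  = step (snd M′)
    next-snd (op o cs Ms)               = op o cs (Vec.map snd Ms)

    next-app : ∀ {σ τ} {M : Program (σ ⇒ τ)} {N : Program σ} →
               Next M → Next N → Next (app M N)
    next-app {N = V} (value (lam M)) (value _) = step (M [ V ])
    next-app (value (lam M)) (step N′)         = step (app (lam M) N′)
    next-app (value (lam M)) (op o cs Ns)      =
      op o cs (Vec.map (app (lam M)) Ns)
    next-app {N = N} (step M′) _               = step (app M′ N)
    next-app {N = N} (op o cs Ms) _            =
      op o cs (Vec.map (λ M → app M N) Ms)

  mutual
    next : ∀ {σ} (M : Program σ) → Next M
    next (var ())
    next (const c)    = value (const c)
    next (fun f Ms)   = next-fun f (next* Ms)
    next (cond L M N) = next-cond M N (next L)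
    next (op o Ns Ms) = next-op o Ms (next* Ns)
    next ⋆            = value ⋆
    next (pair M N)   = next-pair (next M) (next N)
    next (fst M)      = next-fst (next M)
    next (snd M)      = next-snd (next M)
    next (lam M)      = value (lam M)
    next (app M N)    = next-app (next M) (next N)

    next* : ∀ {bs} (Ms : Args [] bs) → Next* Ms
    next* []       = value []
    next* (M ∷ Ms) = next-∷ (next M) (next* Ms)

  next-value : ∀ {σ} {V : Program σ} (v : Value V) → next V ≡ value v
  next-value (const c)  = refl
  next-value ⋆          = refl
  next-value (pair v w) = cong₂ next-pair (next-value v) (next-value w)
  next-value (lam M)    = refl

  next-consts : ∀ {bs} (cs : All Const bs) → next* (consts cs) ≡ value cs
  next-consts []       = refl
  next-consts (c ∷ cs) = cong (next-∷ (value (const c))) (next-consts cs)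

  next-↦ : ∀ {σ} {Q Q′ : Program σ} → Q ↦ Q′ → next Q ≡ step Q′
  next-↦ (fun f cs) = cong (next-fun f) (next-consts cs)
  next-↦ cond-tt    = refl
  next-↦ cond-ff    = refl
  next-↦ (fst v w)  = cong next-fst (next-value (pair v w))
  next-↦ (snd v w)  = cong next-snd (next-value (pair v w))
  next-↦ (β M v)    = cong (next-app (value (lam M))) (next-value v)

  mutual
    next-step : ∀ {ρ σ} (E : ECtx ρ σ) {Q Q′ : Program ρ} → Q ↦ Q′ →
                next (plug E Q) ≡ step (plug E Q′)
    next-step ∙            r = next-↦ r
    next-step (fun f A)    r = cong (next-fun f) (next-step* A r)
    next-step (cond E M N) r = cong (next-cond M N) (next-step E r)
    next-step (op o A Ms)  r = cong (next-op o Ms) (next-step* A r)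
    next-step (pairˡ E N)  r = cong (λ x → next-pair x (next N)) (next-step E r)
    next-step (pairʳ v E)  r = cong₂ next-pair (next-value v) (next-step E r)
    next-step (fst E)      r = cong next-fst (next-step E r)
    next-step (snd E)      r = cong next-snd (next-step E r)
    next-step (appˡ E N)   r = cong (λ x → next-app x (next N)) (next-step E r)
    next-step (appʳ M E)   r = cong (next-app (value (lam M))) (next-step E r)

    next-step* : ∀ {ρ bs} (A : ArgsECtx ρ bs) {Q Q′ : Program ρ} → Q ↦ Q′ →
                 next* (plug* A Q) ≡ step (plug* A Q′)
    next-step* (hole E Ms) r = cong (λ x → next-∷ x (next* Ms)) (next-step E r)
    next-step* (skip c A)  r = cong (next-∷ (value (const c))) (next-step* A r)

  private
    map-map : ∀ {A B C : Set} {m} {M : Set} {f : B → C} {g : A → B}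
              (k : Vec C m → M) (xs : Vec A m) →
              k (Vec.map f (Vec.map g xs)) ≡ k (Vec.map (λ x → f (g x)) xs)
    map-map {f = f} {g} k xs = cong k (sym (Vec.map-∘ f g xs))

  module _ {ρ bs m} (o : OpSym bs m) (cs : All Const bs)
           (Ms : Vec (Program ρ) m) where
    mutual
      next-perform : ∀ {σ} (E : ECtx ρ σ) →
                     next (plug E (op o (consts cs) Ms)) ≡
                     op o cs (Vec.map (plug E) Ms)
      next-perform ∙ =
        trans (cong (next-op o Ms) (next-consts cs))
              (cong (op o cs) (sym (Vec.map-id Ms)))
      next-perform (fun f A) =
        trans (cong (next-fun f) (next-perform* A)) (map-map (op o cs) Ms)
      next-perform (cond E M N) =
        trans (cong (next-cond M N) (next-perform E)) (map-map (op o cs) Ms)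
      next-perform (op o′ A Ms′) =
        trans (cong (next-op o′ Ms′) (next-perform* A)) (map-map (op o cs) Ms)
      next-perform (pairˡ E N) =
        trans (cong (λ x → next-pair x (next N)) (next-perform E))
              (map-map (op o cs) Ms)
      next-perform (pairʳ v E) =
        trans (cong₂ next-pair (next-value v) (next-perform E))
              (map-map (op o cs) Ms)
      next-perform (fst E) =
        trans (cong next-fst (next-perform E)) (map-map (op o cs) Ms)
      next-perform (snd E) =
        trans (cong next-snd (next-perform E)) (map-map (op o cs) Ms)
      next-perform (appˡ E N) =
        trans (cong (λ x → next-app x (next N)) (next-perform E))
              (map-map (op o cs) Ms)
      next-perform (appʳ M E) =
        trans (cong (next-app (value (lam M))) (next-perform E))
              (map-map (op o cs) Ms)

      next-perform* : ∀ {bs′} (A : ArgsECtx ρ bs′) →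
                      next* (plug* A (op o (consts cs) Ms)) ≡
                      op o cs (Vec.map (plug* A) Ms)
      next-perform* (hole E Ms′) =
        trans (cong (λ x → next-∷ x (next* Ms′)) (next-perform E))
              (map-map (op o cs) Ms)
      next-perform* (skip c A) =
        trans (cong (next-∷ (value (const c))) (next-perform* A))
              (map-map (op o cs) Ms)

  private
    Result : ∀ {σ} (M : Program σ) → Next M → Program σ → Set
    Result M (value _)      E = M ≡ E
    Result M (step M′)      E = M′ ⇓ E
    Result M (op o cs M′s)  E =
      ∃[ Es ] op o (consts cs) Es ≡ E ×
              (∀ i → Vec.lookup M′s i ⇓ Vec.lookup Es i)

    ⇓-result : ∀ {σ} {M E : Program σ} → M ⇓ E → Result M (next M) E
    ⇓-result {E = E} (value v) =
      subst (λ n → Result _ n E) (sym (next-value v)) refl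
    ⇓-result {E = E} (step (within ℰ r) d) =
      subst (λ n → Result _ n E) (sym (next-step ℰ r)) d
    ⇓-result {E = E} (op ℰ o cs Ms Es ds) =
      subst (λ n → Result _ n E) (sym (next-perform o cs Ms ℰ))
        (Es , refl , λ i →
          subst (_⇓ _) (sym (Vec.lookup-map i (plug ℰ) Ms)) (ds i))

  ⇓-unique : ∀ {σ} {M E E′ : Program σ} → M ⇓ E → M ⇓ E′ → E ≡ E′
  ⇓-unique (value v) d′ =
    subst (λ n → Result _ n _) (next-value v) (⇓-result d′)
  ⇓-unique (step (within ℰ r) d) d′ =
    ⇓-unique d (subst (λ n → Result _ n _) (next-step ℰ r) (⇓-result d′))
  ⇓-unique (op ℰ o cs Ms Es ds) d′
    with Es′ , refl , ds′ ←
      subst (λ n → Result _ n _) (next-perform o cs Ms ℰ) (⇓-result d′)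
    = cong (op o (consts cs)) (PW.Pointwise-≡⇒≡ (PW.ext λ i →
        ⇓-unique (ds i)
          (subst (_⇓ _) (Vec.lookup-map i (plug ℰ) Ms) (ds′ i))))

  mutual
    ren-ren : ∀ {Γ Δ Θ σ} {r : Ren Γ Δ} {r′ : Ren Δ Θ} {r″ : Ren Γ Θ} →
              (∀ {σ} (x : σ ∈ Γ) → r′ (r x) ≡ r″ x) →
              (M : Term Γ σ) → ren r′ (ren r M) ≡ ren r″ M
    ren-ren e (var x)      = cong var (e x)
    ren-ren e (const c)    = refl
    ren-ren e (fun f Ms)   = cong (fun f) (ren-ren* e Ms)
    ren-ren e (cond L M N) =
      trans (cong₂ (λ A B → cond A B _) (ren-ren e L) (ren-ren e M))
            (cong (cond _ _) (ren-ren e N))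
    ren-ren e (op o Ns Ms) = cong₂ (op o) (ren-ren* e Ns) (ren-renᵛ e Ms)
    ren-ren e ⋆            = refl
    ren-ren e (pair M N)   = cong₂ pair (ren-ren e M) (ren-ren e N)
    ren-ren e (fst M)      = cong fst (ren-ren e M)
    ren-ren e (snd M)      = cong snd (ren-ren e M)
    ren-ren e (lam M)      =
      cong lam (ren-ren (λ { (here p) → refl ; (there x) → cong there (e x) }) M)
    ren-ren e (app M N)    = cong₂ app (ren-ren e M) (ren-ren e N)

    ren-ren* : ∀ {Γ Δ Θ bs} {r : Ren Γ Δ} {r′ : Ren Δ Θ} {r″ : Ren Γ Θ} →
               (∀ {σ} (x : σ ∈ Γ) → r′ (r x) ≡ r″ x) →
               (Ms : Args Γ bs) → ren* r′ (ren* r Ms) ≡ ren* r″ Ms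
    ren-ren* e []       = refl
    ren-ren* e (M ∷ Ms) = cong₂ _∷_ (ren-ren e M) (ren-ren* e Ms)

    ren-renᵛ : ∀ {Γ Δ Θ σ m} {r : Ren Γ Δ} {r′ : Ren Δ Θ} {r″ : Ren Γ Θ} →
               (∀ {σ} (x : σ ∈ Γ) → r′ (r x) ≡ r″ x) →
               (Ms : Vec (Term Γ σ) m) → renᵛ r′ (renᵛ r Ms) ≡ renᵛ r″ Ms
    ren-renᵛ e []       = refl
    ren-renᵛ e (M ∷ Ms) = cong₂ _∷_ (ren-ren e M) (ren-renᵛ e Ms)

  mutual
    sub-ren : ∀ {Γ Δ Θ σ} {r : Ren Γ Δ} {s : Sub Δ Θ} {t : Sub Γ Θ} →
              (∀ {σ} (x : σ ∈ Γ) → s (r x) ≡ t x) →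
              (M : Term Γ σ) → sub s (ren r M) ≡ sub t M
    sub-ren e (var x)      = e x
    sub-ren e (const c)    = refl
    sub-ren e (fun f Ms)   = cong (fun f) (sub-ren* e Ms)
    sub-ren e (cond L M N) =
      trans (cong₂ (λ A B → cond A B _) (sub-ren e L) (sub-ren e M))
            (cong (cond _ _) (sub-ren e N))
    sub-ren e (op o Ns Ms) = cong₂ (op o) (sub-ren* e Ns) (sub-renᵛ e Ms)
    sub-ren e ⋆            = refl
    sub-ren e (pair M N)   = cong₂ pair (sub-ren e M) (sub-ren e N)
    sub-ren e (fst M)      = cong fst (sub-ren e M)
    sub-ren e (snd M)      = cong snd (sub-ren e M)
    sub-ren e (lam M)      =
      cong lam (sub-ren
        (λ { (here p) → refl ; (there x) → cong (ren there) (e x) }) M)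
    sub-ren e (app M N)    = cong₂ app (sub-ren e M) (sub-ren e N)

    sub-ren* : ∀ {Γ Δ Θ bs} {r : Ren Γ Δ} {s : Sub Δ Θ} {t : Sub Γ Θ} →
               (∀ {σ} (x : σ ∈ Γ) → s (r x) ≡ t x) →
               (Ms : Args Γ bs) → sub* s (ren* r Ms) ≡ sub* t Ms
    sub-ren* e []       = refl
    sub-ren* e (M ∷ Ms) = cong₂ _∷_ (sub-ren e M) (sub-ren* e Ms)

    sub-renᵛ : ∀ {Γ Δ Θ σ m} {r : Ren Γ Δ} {s : Sub Δ Θ} {t : Sub Γ Θ} →
               (∀ {σ} (x : σ ∈ Γ) → s (r x) ≡ t x) →
               (Ms : Vec (Term Γ σ) m) → subᵛ s (renᵛ r Ms) ≡ subᵛ t Ms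
    sub-renᵛ e []       = refl
    sub-renᵛ e (M ∷ Ms) = cong₂ _∷_ (sub-ren e M) (sub-renᵛ e Ms)

  mutual
    ren-sub : ∀ {Γ Δ Θ σ} {s : Sub Γ Δ} {r : Ren Δ Θ} {t : Sub Γ Θ} →
              (∀ {σ} (x : σ ∈ Γ) → ren r (s x) ≡ t x) →
              (M : Term Γ σ) → ren r (sub s M) ≡ sub t M
    ren-sub e (var x)      = e x
    ren-sub e (const c)    = refl
    ren-sub e (fun f Ms)   = cong (fun f) (ren-sub* e Ms)
    ren-sub e (cond L M N) =
      trans (cong₂ (λ A B → cond A B _) (ren-sub e L) (ren-sub e M))
            (cong (cond _ _) (ren-sub e N))
    ren-sub e (op o Ns Ms) = cong₂ (op o) (ren-sub* e Ns) (ren-subᵛ e Ms)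
    ren-sub e ⋆            = refl
    ren-sub e (pair M N)   = cong₂ pair (ren-sub e M) (ren-sub e N)
    ren-sub e (fst M)      = cong fst (ren-sub e M)
    ren-sub e (snd M)      = cong snd (ren-sub e M)
    ren-sub {s = s} {r} e (lam M) =
      cong lam (ren-sub
        (λ { (here p)  → refl
           ; (there x) → trans (ren-ren {r″ = λ y → there (r y)} (λ _ → refl) (s x))
                        (trans (sym (ren-ren (λ _ → refl) (s x)))
                               (cong (ren there) (e x))) }) M)
    ren-sub e (app M N)    = cong₂ app (ren-sub e M) (ren-sub e N)

    ren-sub* : ∀ {Γ Δ Θ bs} {s : Sub Γ Δ} {r : Ren Δ Θ} {t : Sub Γ Θ} →
               (∀ {σ} (x : σ ∈ Γ) → ren r (s x) ≡ t x) →
               (Ms : Args Γ bs) → ren* r (sub* s Ms) ≡ sub* t Ms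
    ren-sub* e []       = refl
    ren-sub* e (M ∷ Ms) = cong₂ _∷_ (ren-sub e M) (ren-sub* e Ms)

    ren-subᵛ : ∀ {Γ Δ Θ σ m} {s : Sub Γ Δ} {r : Ren Δ Θ} {t : Sub Γ Θ} →
               (∀ {σ} (x : σ ∈ Γ) → ren r (s x) ≡ t x) →
               (Ms : Vec (Term Γ σ) m) → renᵛ r (subᵛ s Ms) ≡ subᵛ t Ms
    ren-subᵛ e []       = refl
    ren-subᵛ e (M ∷ Ms) = cong₂ _∷_ (ren-sub e M) (ren-subᵛ e Ms)

  mutual
    sub-sub : ∀ {Γ Δ Θ σ} {s : Sub Γ Δ} {u : Sub Δ Θ} {t : Sub Γ Θ} →
              (∀ {σ} (x : σ ∈ Γ) → sub u (s x) ≡ t x) →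
              (M : Term Γ σ) → sub u (sub s M) ≡ sub t M
    sub-sub e (var x)      = e x
    sub-sub e (const c)    = refl
    sub-sub e (fun f Ms)   = cong (fun f) (sub-sub* e Ms)
    sub-sub e (cond L M N) =
      trans (cong₂ (λ A B → cond A B _) (sub-sub e L) (sub-sub e M))
            (cong (cond _ _) (sub-sub e N))
    sub-sub e (op o Ns Ms) = cong₂ (op o) (sub-sub* e Ns) (sub-subᵛ e Ms)
    sub-sub e ⋆            = refl
    sub-sub e (pair M N)   = cong₂ pair (sub-sub e M) (sub-sub e N)
    sub-sub e (fst M)      = cong fst (sub-sub e M)
    sub-sub e (snd M)      = cong snd (sub-sub e M)
    sub-sub {s = s} {u} e (lam M) =
      cong lam (sub-sub
        (λ { (here p)  → refl
           ; (there x) →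
               trans (sub-ren {t = λ y → ren there (u y)} (λ _ → refl) (s x))
              (trans (sym (ren-sub (λ _ → refl) (s x)))
                     (cong (ren there) (e x))) }) M)
    sub-sub e (app M N)    = cong₂ app (sub-sub e M) (sub-sub e N)

    sub-sub* : ∀ {Γ Δ Θ bs} {s : Sub Γ Δ} {u : Sub Δ Θ} {t : Sub Γ Θ} →
               (∀ {σ} (x : σ ∈ Γ) → sub u (s x) ≡ t x) →
               (Ms : Args Γ bs) → sub* u (sub* s Ms) ≡ sub* t Ms
    sub-sub* e []       = refl
    sub-sub* e (M ∷ Ms) = cong₂ _∷_ (sub-sub e M) (sub-sub* e Ms)

    sub-subᵛ : ∀ {Γ Δ Θ σ m} {s : Sub Γ Δ} {u : Sub Δ Θ} {t : Sub Γ Θ} →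
               (∀ {σ} (x : σ ∈ Γ) → sub u (s x) ≡ t x) →
               (Ms : Vec (Term Γ σ) m) → subᵛ u (subᵛ s Ms) ≡ subᵛ t Ms
    sub-subᵛ e []       = refl
    sub-subᵛ e (M ∷ Ms) = cong₂ _∷_ (sub-sub e M) (sub-subᵛ e Ms)

  mutual
    sub-id : ∀ {Γ σ} {s : Sub Γ Γ} → (∀ {σ} (x : σ ∈ Γ) → s x ≡ var x) →
             (M : Term Γ σ) → sub s M ≡ M
    sub-id e (var x)      = e x
    sub-id e (const c)    = refl
    sub-id e (fun f Ms)   = cong (fun f) (sub-id* e Ms)
    sub-id e (cond L M N) =
      trans (cong₂ (λ A B → cond A B _) (sub-id e L) (sub-id e M))
            (cong (cond _ _) (sub-id e N))
    sub-id e (op o Ns Ms) = cong₂ (op o) (sub-id* e Ns) (sub-idᵛ e Ms)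
    sub-id e ⋆            = refl
    sub-id e (pair M N)   = cong₂ pair (sub-id e M) (sub-id e N)
    sub-id e (fst M)      = cong fst (sub-id e M)
    sub-id e (snd M)      = cong snd (sub-id e M)
    sub-id e (lam M)      =
      cong lam (sub-id
        (λ { (here p) → refl ; (there x) → cong (ren there) (e x) }) M)
    sub-id e (app M N)    = cong₂ app (sub-id e M) (sub-id e N)

    sub-id* : ∀ {Γ bs} {s : Sub Γ Γ} → (∀ {σ} (x : σ ∈ Γ) → s x ≡ var x) →
              (Ms : Args Γ bs) → sub* s Ms ≡ Ms
    sub-id* e []       = refl
    sub-id* e (M ∷ Ms) = cong₂ _∷_ (sub-id e M) (sub-id* e Ms)

    sub-idᵛ : ∀ {Γ σ m} {s : Sub Γ Γ} → (∀ {σ} (x : σ ∈ Γ) → s x ≡ var x) →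
              (Ms : Vec (Term Γ σ) m) → subᵛ s Ms ≡ Ms
    sub-idᵛ e []       = refl
    sub-idᵛ e (M ∷ Ms) = cong₂ _∷_ (sub-id e M) (sub-idᵛ e Ms)

  mutual
    _⊙_ : ∀ {ρ σ τ} → ECtx σ τ → ECtx ρ σ → ECtx ρ τ
    ∙          ⊙ E = E
    fun f A    ⊙ E = fun f (A ⊙* E)
    cond F M N ⊙ E = cond (F ⊙ E) M N
    op o A Ms  ⊙ E = op o (A ⊙* E) Ms
    pairˡ F N  ⊙ E = pairˡ (F ⊙ E) N
    pairʳ v F  ⊙ E = pairʳ v (F ⊙ E)
    fst F      ⊙ E = fst (F ⊙ E)
    snd F      ⊙ E = snd (F ⊙ E)
    appˡ F N   ⊙ E = appˡ (F ⊙ E) N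
    appʳ M F   ⊙ E = appʳ M (F ⊙ E)

    _⊙*_ : ∀ {ρ σ bs} → ArgsECtx σ bs → ECtx ρ σ → ArgsECtx ρ bs
    hole F Ms ⊙* E = hole (F ⊙ E) Ms
    skip c A  ⊙* E = skip c (A ⊙* E)

  mutual
    plug-⊙ : ∀ {ρ σ τ} (F : ECtx σ τ) (E : ECtx ρ σ) (Q : Program ρ) →
             plug (F ⊙ E) Q ≡ plug F (plug E Q)
    plug-⊙ ∙            E Q = refl
    plug-⊙ (fun f A)    E Q = cong (fun f) (plug-⊙* A E Q)
    plug-⊙ (cond F M N) E Q = cong (λ L → cond L M N) (plug-⊙ F E Q)
    plug-⊙ (op o A Ms)  E Q = cong (λ Ns → op o Ns Ms) (plug-⊙* A E Q)
    plug-⊙ (pairˡ F N)  E Q = cong (λ M → pair M N) (plug-⊙ F E Q)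
    plug-⊙ (pairʳ v F)  E Q = cong (pair _) (plug-⊙ F E Q)
    plug-⊙ (fst F)      E Q = cong fst (plug-⊙ F E Q)
    plug-⊙ (snd F)      E Q = cong snd (plug-⊙ F E Q)
    plug-⊙ (appˡ F N)   E Q = cong (λ M → app M N) (plug-⊙ F E Q)
    plug-⊙ (appʳ M F)   E Q = cong (app (lam M)) (plug-⊙ F E Q)

    plug-⊙* : ∀ {ρ σ bs} (A : ArgsECtx σ bs) (E : ECtx ρ σ) (Q : Program ρ) →
              plug* (A ⊙* E) Q ≡ plug* A (plug E Q)
    plug-⊙* (hole F Ms) E Q = cong (_∷ Ms) (plug-⊙ F E Q)
    plug-⊙* (skip c A)  E Q = cong (const c ∷_) (plug-⊙* A E Q)

  -- M evaluates, along every choice of arms, to values satisfying P.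

  data Terminates {σ} (P : ∀ {V : Program σ} → Value V → Set) :
                  Program σ → Set where
    value : ∀ {V} (v : Value V) → P v → Terminates P V
    step  : ∀ {M M′} → M ⟶ M′ → Terminates P M′ → Terminates P M
    op    : ∀ {ρ bs m} (ℰ : ECtx ρ σ) (o : OpSym bs m) (cs : All Const bs)
            (Ms : Vec (Program ρ) m) →
            (∀ i → Terminates P (plug ℰ (Vec.lookup Ms i))) →
            Terminates P (plug ℰ (op o (consts cs) Ms))

  Terminates⇒⇓ : ∀ {σ} {P : ∀ {V : Program σ} → Value V → Set} {M} →
                 Terminates P M → ∃[ E ] M ⇓ E
  Terminates⇒⇓ (value v _) = _ , value v
  Terminates⇒⇓ (step r t)  with E , d ← Terminates⇒⇓ t = E , step r d
  Terminates⇒⇓ (op ℰ o cs Ms ts) =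
    op o (consts cs) Es ,
    op ℰ o cs Ms Es (λ i →
      subst (_ ⇓_) (sym (Vec.lookup∘tabulate _ i)) (proj₂ (Terminates⇒⇓ (ts i))))
    where Es = Vec.tabulate (λ i → proj₁ (Terminates⇒⇓ (ts i)))

  bind : ∀ {σ τ} {P : ∀ {V : Program σ} → Value V → Set}
         {Q : ∀ {V : Program τ} → Value V → Set} (F : ECtx σ τ) {M} →
         Terminates P M →
         (∀ {V} (v : Value V) → P v → Terminates Q (plug F V)) →
         Terminates Q (plug F M)
  bind F (value v p) k = k v p
  bind F (step (within E {Q₁} {Q₂} r) t) k =
    subst (Terminates _) (plug-⊙ F E Q₁)
      (step (within (F ⊙ E) r)
        (subst (Terminates _) (sym (plug-⊙ F E Q₂)) (bind F t k)))
  bind F (op ℰ o cs Ms ts) k =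
    subst (Terminates _) (plug-⊙ F ℰ _)
      (op (F ⊙ ℰ) o cs Ms (λ i →
        subst (Terminates _) (sym (plug-⊙ F ℰ _)) (bind F (ts i) k)))

  Computable : ∀ σ {V : Program σ} → Value V → Set
  Computable (base b) v          = ⊤
  Computable unit     v          = ⊤
  Computable (σ ⊗ τ)  (pair v w) = Computable σ v × Computable τ w
  Computable (σ ⇒ τ)  (lam M)    =
    ∀ {V} (v : Value V) → Computable σ v →
    Terminates (Computable τ) (M [ V ])

  ComputableSub : ∀ {Γ} → Sub Γ [] → Set
  ComputableSub {Γ} s =
    ∀ {σ} (x : σ ∈ Γ) → Σ (Value (s x)) (Computable σ)

  mutual
    fundamental : ∀ {Γ σ} (s : Sub Γ []) → ComputableSub s →
                  (M : Term Γ σ) → Terminates (Computable σ) (sub s M)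
    fundamental s p (var x) = value (proj₁ (p x)) (proj₂ (p x))
    fundamental s p (const c) = value (const c) tt
    fundamental s p (fun f Ms) =
      fundamental* s p Ms (fun f) (fun f) (λ _ _ → refl) λ cs →
        step (within ∙ (fun f cs)) (value (const _) tt)
    fundamental s p (cond L M N) =
      bind (cond ∙ _ _) (fundamental s p L) λ
        { (const tt) _ → step (within ∙ cond-tt) (fundamental s p M)
        ; (const ff) _ → step (within ∙ cond-ff) (fundamental s p N) }
    fundamental s p (op o Ns Ms) =
      fundamental* s p Ns (λ Ns′ → op o Ns′ (subᵛ s Ms))
        (λ A → op o A (subᵛ s Ms)) (λ _ _ → refl) λ cs →
        op ∙ o cs (subᵛ s Ms) (fundamentalᵛ s p Ms)
    fundamental s p ⋆ = value ⋆ tt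
    fundamental s p (pair M N) =
      bind (pairˡ ∙ _) (fundamental s p M) λ v pv →
      bind (pairʳ v ∙) (fundamental s p N) λ w pw →
      value (pair v w) (pv , pw)
    fundamental s p (fst M) =
      bind (fst ∙) (fundamental s p M) λ
        { (pair v w) (pv , pw) → step (within ∙ (fst v w)) (value v pv) }
    fundamental s p (snd M) =
      bind (snd ∙) (fundamental s p M) λ
        { (pair v w) (pv , pw) → step (within ∙ (snd v w)) (value w pw) }
    fundamental s p (lam M) = value (lam _) λ {V} v pv →
      subst (Terminates _)
        (sym (sub-sub {t = s ▸ V}
          (λ { (here refl) → refl
             ; (there x)   → trans (sub-ren (λ _ → refl) (s x))
                                   (sub-id (λ _ → refl) (s x)) }) M))
        (fundamental (s ▸ V)
          (λ { (here refl) → v , pv ; (there x) → p x }) M)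
    fundamental s p (app M N) =
      bind (appˡ ∙ _) (fundamental s p M) λ
        { (lam M′) pM → bind (appʳ M′ ∙) (fundamental s p N) λ v pv →
            step (within ∙ (β M′ v)) (pM v pv) }

    fundamental* : ∀ {Γ σ bs} (s : Sub Γ []) → ComputableSub s →
                   {P : ∀ {V : Program σ} → Value V → Set} (Ms : Args Γ bs)
                   (G : Args [] bs → Program σ)
                   (F : ∀ {ρ} → ArgsECtx ρ bs → ECtx ρ σ) →
                   (∀ {ρ} (A : ArgsECtx ρ bs) (Q : Program ρ) →
                     plug (F A) Q ≡ G (plug* A Q)) →
                   (∀ cs → Terminates P (G (consts cs))) →
                   Terminates P (G (sub* s Ms))
    fundamental* s p []       G F e k = k []
    fundamental* s p (M ∷ Ms) G F e k =
      subst (Terminates _) (e (hole ∙ _) _)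
        (bind (F (hole ∙ (sub* s Ms))) (fundamental s p M) λ
          { (const c) _ → subst (Terminates _) (sym (e (hole ∙ _) _))
              (fundamental* s p Ms (λ Ns → G (const c ∷ Ns))
                (λ A → F (skip c A)) (λ A → e (skip c A)) λ cs → k (c ∷ cs)) })

    fundamentalᵛ : ∀ {Γ σ m} (s : Sub Γ []) → ComputableSub s →
                   (Ms : Vec (Term Γ σ) m) →
                   ∀ i → Terminates (Computable σ) (Vec.lookup (subᵛ s Ms) i)
    fundamentalᵛ s p (M ∷ Ms) zero    = fundamental s p M
    fundamentalᵛ s p (M ∷ Ms) (suc i) = fundamentalᵛ s p Ms i

  ⇓-total : ∀ {σ} (M : Program σ) → ∃[ E ] M ⇓ E
  ⇓-total M = Terminates⇒⇓
    (subst (Terminates _) (sub-id (λ ()) M) (fundamental var (λ ()) M))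

  Op : ∀ {σ} → Program σ → Program σ
  Op M = proj₁ (⇓-total M)

  ⇓-Op : ∀ {σ} (M : Program σ) → M ⇓ Op M
  ⇓-Op M = proj₂ (⇓-total M)

  Op-effectValue : ∀ {σ} (M : Program σ) → EffectValue (Op M)
  Op-effectValue M = ⇓-effectValue (⇓-Op M)

  Op-value : ∀ {σ} {V : Program σ} → Value V → Op V ≡ V
  Op-value v = ⇓-unique (⇓-Op _) (value v)

  Op-step : ∀ {σ} {M M′ : Program σ} → M ⟶ M′ → Op M ≡ Op M′
  Op-step r = ⇓-unique (⇓-Op _) (step r (⇓-Op _))

  Op-op : ∀ {ρ σ bs m} (ℰ : ECtx ρ σ) (o : OpSym bs m) (cs : All Const bs)
          (Ms : Vec (Program ρ) m) →
          Op (plug ℰ (op o (consts cs) Ms)) ≡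
          op o (consts cs) (Vec.map (λ M → Op (plug ℰ M)) Ms)
  Op-op ℰ o cs Ms = ⇓-unique (⇓-Op _) (op ℰ o cs Ms _ λ i →
    subst (plug ℰ (Vec.lookup Ms i) ⇓_)
      (sym (Vec.lookup-map i (λ M → Op (plug ℰ M)) Ms))
      (⇓-Op (plug ℰ (Vec.lookup Ms i))))

⟦_⟧Base : ∀ {Sort} → (Sort → Set) → Base Sort → Set
⟦ D ⟧Base bool     = 𝔹.Bool
⟦ D ⟧Base (sort s) = D s

⟦_⟧Constant : ∀ {Sort} {ConstSym D : Sort → Set} →
              (∀ {s} → ConstSym s → D s) →
              ∀ {b} → Constant ConstSym b → ⟦ D ⟧Base b
⟦ d ⟧Constant tt      = true
⟦ d ⟧Constant ff      = false
⟦ d ⟧Constant (con c) = d c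

record Interpretation (S : Signature) (𝒯 : Monad) : Set₁ where
  open Signature S
  open Monad 𝒯
  field
    ⟦_⟧sort  : Sort → Set
    inhabitant : ∀ s → ⟦ s ⟧sort
    ⟦_⟧sym   : ∀ {s} → ConstSym s → ⟦ s ⟧sort

  B⟦_⟧ : Base Sort → Set
  B⟦_⟧ = ⟦ ⟦_⟧sort ⟧Base

  C⟦_⟧ : ∀ {b} → Const b → B⟦ b ⟧
  C⟦_⟧ = ⟦ ⟦_⟧sym ⟧Constant

  field
    distinct : ∀ {b} {c c′ : Const b} → c ≢ c′ → C⟦ c ⟧ ≢ C⟦ c′ ⟧
    F⟦_⟧     : ∀ {bs b} → FunSym bs b → All B⟦_⟧ bs → B⟦ b ⟧
    F⟦⟧-val  : ∀ {bs b} (f : FunSym bs b) (cs : All Const bs) →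
               F⟦ f ⟧ (All.map C⟦_⟧ cs) ≡ C⟦ val f cs ⟧
    generic  : ∀ {bs m} → OpSym bs m → All B⟦_⟧ bs → T (Fin m)

module Semantics (S : Signature) (𝒯 : Monad) (I : Interpretation S 𝒯) where
  open Signature S
  open Language S
  open Monad 𝒯
  open Interpretation I

  operation : ∀ {bs m X} → OpSym bs m → All B⟦_⟧ bs → Vec (T X) m → T X
  operation o os us = (Vec.lookup us †) (generic o os)

  Ty⟦_⟧ : Ty → Set
  Ty⟦ base b ⟧ = B⟦ b ⟧
  Ty⟦ unit ⟧   = ⊤
  Ty⟦ σ ⊗ τ ⟧  = Ty⟦ σ ⟧ × Ty⟦ τ ⟧
  Ty⟦ σ ⇒ τ ⟧  = Ty⟦ σ ⟧ → T Ty⟦ τ ⟧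

  Ctx⟦_⟧ : Ctx → Set
  Ctx⟦_⟧ = All Ty⟦_⟧

  mutual
    M⟦_⟧ : ∀ {Γ σ} → Term Γ σ → Ctx⟦ Γ ⟧ → T Ty⟦ σ ⟧
    M⟦ var x ⟧      ρ = η (All.lookup ρ x)
    M⟦ const c ⟧    ρ = η C⟦ c ⟧
    M⟦ fun f Ms ⟧   ρ = ((λ as → η (F⟦ f ⟧ as)) †) (Args⟦ Ms ⟧ ρ)
    M⟦ cond L M N ⟧ ρ = ((λ b → 𝔹.if b then M⟦ M ⟧ ρ else M⟦ N ⟧ ρ) †) (M⟦ L ⟧ ρ)
    M⟦ op o Ns Ms ⟧ ρ = ((λ os → operation o os (Vec⟦ Ms ⟧ ρ)) †) (Args⟦ Ns ⟧ ρ)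
    M⟦ ⋆ ⟧          ρ = η tt
    M⟦ pair M N ⟧   ρ = ((λ a → ((λ b → η (a , b)) †) (M⟦ N ⟧ ρ)) †) (M⟦ M ⟧ ρ)
    M⟦ fst M ⟧      ρ = ((λ p → η (proj₁ p)) †) (M⟦ M ⟧ ρ)
    M⟦ snd M ⟧      ρ = ((λ p → η (proj₂ p)) †) (M⟦ M ⟧ ρ)
    M⟦ lam M ⟧      ρ = η (λ a → M⟦ M ⟧ (a ∷ ρ))
    M⟦ app M N ⟧    ρ = ((λ φ → ((λ a → φ a) †) (M⟦ N ⟧ ρ)) †) (M⟦ M ⟧ ρ)

    Args⟦_⟧ : ∀ {Γ bs} → Args Γ bs → Ctx⟦ Γ ⟧ → T (All B⟦_⟧ bs)
    Args⟦ [] ⟧     ρ = η []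
    Args⟦ M ∷ Ms ⟧ ρ =
      ((λ a → ((λ as → η (a ∷ as)) †) (Args⟦ Ms ⟧ ρ)) †) (M⟦ M ⟧ ρ)

    Vec⟦_⟧ : ∀ {Γ σ m} → Vec (Term Γ σ) m → Ctx⟦ Γ ⟧ → Vec (T Ty⟦ σ ⟧) m
    Vec⟦ [] ⟧     ρ = []
    Vec⟦ M ∷ Ms ⟧ ρ = M⟦ M ⟧ ρ ∷ Vec⟦ Ms ⟧ ρ

{-# OPTIONS --safe #-}

-- A closed evaluation context ℰ denotes a Kleisli map k with
-- M⟦ ℰ[Q] ⟧ = k† M⟦ Q ⟧.  Hence equations between redexes and their contracta
-- propagate to whole programs, and, since Kleisli extensions commute with the
-- operations op_X, ℰ[op(cs; Mᵢ)] and op(cs; ℰ[Mᵢ]) have the same denotation.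
-- The theorem follows by induction on the evaluation of N to Op(N).

module Submission where

open import Level using (0ℓ)
open import Data.Bool.Base using (if_then_else_)
open import Data.List.Base using ([]; _∷_)
open import Data.List.Membership.Propositional using (_∈_)
open import Data.List.Relation.Unary.All as All using (All; []; _∷_)
open import Data.List.Relation.Unary.Any using (here; there)
open import Data.Product.Base using (_,_; proj₁; proj₂)
open import Data.Unit.Base using (tt)
open import Data.Fin.Base using (zero; suc)
open import Data.Vec.Base as Vec using (Vec; []; _∷_)
open import Relation.Binary.PropositionalEquality
  using (_≡_; refl; sym; trans; cong; cong₂; module ≡-Reasoning)
open import Axiom.Extensionality.Propositional using (Extensionality)
open import Defs

module Soundness (ext : Extensionality 0ℓ 0ℓ)
                 (S : Signature) (𝒯 : Monad) (I : Interpretation S 𝒯) where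
  open Signature S
  open Language S
  open Monad 𝒯
  open Interpretation I
  open Semantics S 𝒯 I
  open ≡-Reasoning

  -- Kleisli extension takes the whole map as its argument, so rewriting under a sequencing step
  -- requires function extensionality.
  †-cong : ∀ {X Y : Set} {f g : X → T Y} {s t : T X} →
           (∀ x → f x ≡ g x) → s ≡ t → (f †) s ≡ (g †) t
  †-cong f≗g s≡t = cong₂ (λ k u → (k †) u) (ext f≗g) s≡t

  †-value : ∀ {X Y : Set} (f : X → T Y) {t : T X} {x : X} →
            t ≡ η x → (f †) t ≡ f x
  †-value f t≡ηx = trans (cong (f †) t≡ηx) (η-† f _)

  †-assoc : ∀ {X Y Z : Set} (g : Y → T Z) (f : X → T Y) {s : T Y} {t : T X} →
            s ≡ (f †) t → (g †) s ≡ ((λ x → (g †) (f x)) †) t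
  †-assoc g f s≡ = trans (cong (g †) s≡) (†-† f g _)

  mutual
    -- Supplies the weakening needed when a substitution passes under `lam`. Environments are
    -- compared entry by entry, a condition that survives extending both by the same element.
    M⟦ren⟧ : ∀ {Γ Δ σ} {r : Ren Γ Δ} {ρ : Ctx⟦ Δ ⟧} {ρ′ : Ctx⟦ Γ ⟧} →
             (∀ {τ} (x : τ ∈ Γ) → All.lookup ρ (r x) ≡ All.lookup ρ′ x) →
             (M : Term Γ σ) → M⟦ ren r M ⟧ ρ ≡ M⟦ M ⟧ ρ′
    M⟦ren⟧ e (var x)      = cong η (e x)
    M⟦ren⟧ e (const c)    = refl
    M⟦ren⟧ e (fun f Ms)   = cong (_ †) (Args⟦ren⟧ e Ms)
    M⟦ren⟧ e (cond L M N) =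
      †-cong (λ b → cong₂ (if b then_else_) (M⟦ren⟧ e M) (M⟦ren⟧ e N))
             (M⟦ren⟧ e L)
    M⟦ren⟧ e (op o Ns Ms) =
      †-cong (λ os → cong (operation o os) (Vec⟦ren⟧ e Ms)) (Args⟦ren⟧ e Ns)
    M⟦ren⟧ e ⋆            = refl
    M⟦ren⟧ e (pair M N)   =
      †-cong (λ _ → cong (_ †) (M⟦ren⟧ e N)) (M⟦ren⟧ e M)
    M⟦ren⟧ e (fst M)      = cong (_ †) (M⟦ren⟧ e M)
    M⟦ren⟧ e (snd M)      = cong (_ †) (M⟦ren⟧ e M)
    M⟦ren⟧ e (lam M)      = cong η (ext λ a →
      M⟦ren⟧ (λ { (here refl) → refl ; (there x) → e x }) M)
    M⟦ren⟧ e (app M N)    =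
      †-cong (λ _ → cong (_ †) (M⟦ren⟧ e N)) (M⟦ren⟧ e M)

    Args⟦ren⟧ : ∀ {Γ Δ bs} {r : Ren Γ Δ} {ρ : Ctx⟦ Δ ⟧} {ρ′ : Ctx⟦ Γ ⟧} →
                (∀ {τ} (x : τ ∈ Γ) → All.lookup ρ (r x) ≡ All.lookup ρ′ x) →
                (Ms : Args Γ bs) → Args⟦ ren* r Ms ⟧ ρ ≡ Args⟦ Ms ⟧ ρ′
    Args⟦ren⟧ e []       = refl
    Args⟦ren⟧ e (M ∷ Ms) =
      †-cong (λ _ → cong (_ †) (Args⟦ren⟧ e Ms)) (M⟦ren⟧ e M)

    Vec⟦ren⟧ : ∀ {Γ Δ σ m} {r : Ren Γ Δ} {ρ : Ctx⟦ Δ ⟧} {ρ′ : Ctx⟦ Γ ⟧} →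
               (∀ {τ} (x : τ ∈ Γ) → All.lookup ρ (r x) ≡ All.lookup ρ′ x) →
               (Ms : Vec (Term Γ σ) m) → Vec⟦ renᵛ r Ms ⟧ ρ ≡ Vec⟦ Ms ⟧ ρ′
    Vec⟦ren⟧ e []       = refl
    Vec⟦ren⟧ e (M ∷ Ms) = cong₂ _∷_ (M⟦ren⟧ e M) (Vec⟦ren⟧ e Ms)

  mutual
    -- The hypothesis forces s to substitute effect-free terms; for other terms
    -- the equation fails under call-by-value.
    M⟦sub⟧ : ∀ {Γ Δ σ} {s : Sub Γ Δ} {ρ : Ctx⟦ Δ ⟧} {ρ′ : Ctx⟦ Γ ⟧} →
             (∀ {τ} (x : τ ∈ Γ) → M⟦ s x ⟧ ρ ≡ η (All.lookup ρ′ x)) →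
             (M : Term Γ σ) → M⟦ sub s M ⟧ ρ ≡ M⟦ M ⟧ ρ′
    M⟦sub⟧ e (var x)      = e x
    M⟦sub⟧ e (const c)    = refl
    M⟦sub⟧ e (fun f Ms)   = cong (_ †) (Args⟦sub⟧ e Ms)
    M⟦sub⟧ e (cond L M N) =
      †-cong (λ b → cong₂ (if b then_else_) (M⟦sub⟧ e M) (M⟦sub⟧ e N))
             (M⟦sub⟧ e L)
    M⟦sub⟧ e (op o Ns Ms) =
      †-cong (λ os → cong (operation o os) (Vec⟦sub⟧ e Ms)) (Args⟦sub⟧ e Ns)
    M⟦sub⟧ e ⋆            = refl
    M⟦sub⟧ e (pair M N)   =
      †-cong (λ _ → cong (_ †) (M⟦sub⟧ e N)) (M⟦sub⟧ e M)
    M⟦sub⟧ e (fst M)      = cong (_ †) (M⟦sub⟧ e M)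
    M⟦sub⟧ e (snd M)      = cong (_ †) (M⟦sub⟧ e M)
    M⟦sub⟧ {s = s} e (lam M) = cong η (ext λ a →
      M⟦sub⟧ (λ { (here refl) → refl
                -- The lifted substitution weakens `s x`; weakening ignores the new entry `a`, so
                -- the hypothesis for `x` still applies.
                ; (there x)   → trans (M⟦ren⟧ (λ _ → refl) (s x)) (e x) }) M)
    M⟦sub⟧ e (app M N)    =
      †-cong (λ _ → cong (_ †) (M⟦sub⟧ e N)) (M⟦sub⟧ e M)

    Args⟦sub⟧ : ∀ {Γ Δ bs} {s : Sub Γ Δ} {ρ : Ctx⟦ Δ ⟧} {ρ′ : Ctx⟦ Γ ⟧} →
                (∀ {τ} (x : τ ∈ Γ) → M⟦ s x ⟧ ρ ≡ η (All.lookup ρ′ x)) →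
                (Ms : Args Γ bs) → Args⟦ sub* s Ms ⟧ ρ ≡ Args⟦ Ms ⟧ ρ′
    Args⟦sub⟧ e []       = refl
    Args⟦sub⟧ e (M ∷ Ms) =
      †-cong (λ _ → cong (_ †) (Args⟦sub⟧ e Ms)) (M⟦sub⟧ e M)

    Vec⟦sub⟧ : ∀ {Γ Δ σ m} {s : Sub Γ Δ} {ρ : Ctx⟦ Δ ⟧} {ρ′ : Ctx⟦ Γ ⟧} →
               (∀ {τ} (x : τ ∈ Γ) → M⟦ s x ⟧ ρ ≡ η (All.lookup ρ′ x)) →
               (Ms : Vec (Term Γ σ) m) → Vec⟦ subᵛ s Ms ⟧ ρ ≡ Vec⟦ Ms ⟧ ρ′
    Vec⟦sub⟧ e []       = refl
    Vec⟦sub⟧ e (M ∷ Ms) = cong₂ _∷_ (M⟦sub⟧ e M) (Vec⟦sub⟧ e Ms)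

  lookup-Vec⟦⟧ : ∀ {Γ σ m} (Ms : Vec (Term Γ σ) m) (ρ : Ctx⟦ Γ ⟧) i →
                 Vec.lookup (Vec⟦ Ms ⟧ ρ) i ≡ M⟦ Vec.lookup Ms i ⟧ ρ
  lookup-Vec⟦⟧ (M ∷ Ms) ρ zero    = refl
  lookup-Vec⟦⟧ (M ∷ Ms) ρ (suc i) = lookup-Vec⟦⟧ Ms ρ i

  -- Defined by recursion on the evidence that the program is a value: nothing can be extracted from
  -- an element of `T`, and `η` is not assumed injective.
  V⟦_⟧ : ∀ {σ} {V : Program σ} → Value V → Ty⟦ σ ⟧
  V⟦ const c ⟧  = C⟦ c ⟧
  V⟦ ⋆ ⟧        = tt
  V⟦ pair v w ⟧ = V⟦ v ⟧ , V⟦ w ⟧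
  V⟦ lam M ⟧    = λ a → M⟦ M ⟧ (a ∷ [])

  M⟦value⟧ : ∀ {σ} {V : Program σ} (v : Value V) → M⟦ V ⟧ [] ≡ η V⟦ v ⟧
  M⟦value⟧ (const c)  = refl
  M⟦value⟧ ⋆          = refl
  M⟦value⟧ (pair v w) =
    trans (†-value _ (M⟦value⟧ v)) (†-value _ (M⟦value⟧ w))
  M⟦value⟧ (lam M)    = refl

  Args⟦consts⟧ : ∀ {Γ bs} (cs : All Const bs) (ρ : Ctx⟦ Γ ⟧) →
                 Args⟦ consts cs ⟧ ρ ≡ η (All.map C⟦_⟧ cs)
  Args⟦consts⟧ []       ρ = refl
  Args⟦consts⟧ (c ∷ cs) ρ =
    trans (†-value _ refl) (†-value _ (Args⟦consts⟧ cs ρ))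

  -- Constant parameters sequence trivially, leaving one Kleisli extension applied to the generic
  -- effect. In this form associativity alone carries a context into the arms.
  M⟦op-consts⟧ : ∀ {Γ σ bs m} (o : OpSym bs m) (cs : All Const bs)
                 (Ms : Vec (Term Γ σ) m) (ρ : Ctx⟦ Γ ⟧) →
                 M⟦ op o (consts cs) Ms ⟧ ρ ≡
                 ((λ i → M⟦ Vec.lookup Ms i ⟧ ρ) †)
                   (generic o (All.map C⟦_⟧ cs))
  M⟦op-consts⟧ o cs Ms ρ =
    trans (†-value _ (Args⟦consts⟧ cs ρ)) (†-cong (lookup-Vec⟦⟧ Ms ρ) refl)

  M⟦↦⟧ : ∀ {σ} {Q Q′ : Program σ} → Q ↦ Q′ → M⟦ Q ⟧ [] ≡ M⟦ Q′ ⟧ []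
  M⟦↦⟧ (fun f cs) =
    trans (†-value _ (Args⟦consts⟧ cs [])) (cong η (F⟦⟧-val f cs))
  M⟦↦⟧ cond-tt    = η-† _ _
  M⟦↦⟧ cond-ff    = η-† _ _
  M⟦↦⟧ (fst v w)  =
    trans (†-value _ (M⟦value⟧ (pair v w))) (sym (M⟦value⟧ v))
  M⟦↦⟧ (snd v w)  =
    trans (†-value _ (M⟦value⟧ (pair v w))) (sym (M⟦value⟧ w))
  M⟦↦⟧ (β M {V} v) = begin
    M⟦ app (lam M) V ⟧ []                  ≡⟨ η-† _ _ ⟩
    ((λ a → M⟦ M ⟧ (a ∷ [])) †) (M⟦ V ⟧ []) ≡⟨ †-value _ (M⟦value⟧ v) ⟩
    -- The substitution lemma applies because the substituted term is a value, hence denotes a unit.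
    M⟦ M ⟧ (V⟦ v ⟧ ∷ [])                   ≡⟨ M⟦sub⟧ (λ { (here refl) → M⟦value⟧ v }) M ⟨
    M⟦ M [ V ] ⟧ []                        ∎

  mutual
    -- The argument is the result returned by the program in the hole. What stands evaluated to the
    -- left of the hole (`pairʳ`, `appʳ`, `skip`) enters as an element instead of being sequenced.
    E⟦_⟧ : ∀ {ρ σ} → ECtx ρ σ → Ty⟦ ρ ⟧ → T Ty⟦ σ ⟧
    E⟦ ∙ ⟧          x = η x
    E⟦ fun f A ⟧    x = ((λ as → η (F⟦ f ⟧ as)) †) (E*⟦ A ⟧ x)
    E⟦ cond E M N ⟧ x =
      ((λ b → if b then M⟦ M ⟧ [] else M⟦ N ⟧ []) †) (E⟦ E ⟧ x)
    E⟦ op o A Ms ⟧  x = ((λ os → operation o os (Vec⟦ Ms ⟧ [])) †) (E*⟦ A ⟧ x)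
    E⟦ pairˡ E N ⟧  x =
      ((λ a → ((λ b → η (a , b)) †) (M⟦ N ⟧ [])) †) (E⟦ E ⟧ x)
    E⟦ pairʳ v E ⟧  x = ((λ b → η (V⟦ v ⟧ , b)) †) (E⟦ E ⟧ x)
    E⟦ fst E ⟧      x = ((λ p → η (proj₁ p)) †) (E⟦ E ⟧ x)
    E⟦ snd E ⟧      x = ((λ p → η (proj₂ p)) †) (E⟦ E ⟧ x)
    E⟦ appˡ E N ⟧   x = ((λ φ → ((λ a → φ a) †) (M⟦ N ⟧ [])) †) (E⟦ E ⟧ x)
    E⟦ appʳ M E ⟧   x = ((λ a → M⟦ M ⟧ (a ∷ [])) †) (E⟦ E ⟧ x)

    E*⟦_⟧ : ∀ {ρ bs} → ArgsECtx ρ bs → Ty⟦ ρ ⟧ → T (All B⟦_⟧ bs)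
    E*⟦ hole E Ms ⟧ x =
      ((λ a → ((λ as → η (a ∷ as)) †) (Args⟦ Ms ⟧ [])) †) (E⟦ E ⟧ x)
    E*⟦ skip c A ⟧  x = ((λ as → η (C⟦ c ⟧ ∷ as)) †) (E*⟦ A ⟧ x)

  mutual
    -- Once the unit law discharges any value to the left, each frame is a Kleisli extension applied
    -- to the subterm containing the hole, and associativity absorbs it into the map of the context.
    -- The empty context is the right unit law.
    M⟦plug⟧ : ∀ {ρ σ} (E : ECtx ρ σ) (Q : Program ρ) →
              M⟦ plug E Q ⟧ [] ≡ (E⟦ E ⟧ †) (M⟦ Q ⟧ [])
    M⟦plug⟧ ∙            Q = sym (†-η _)
    M⟦plug⟧ (fun f A)    Q = †-assoc _ _ (Args⟦plug⟧ A Q)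
    M⟦plug⟧ (cond E M N) Q = †-assoc _ _ (M⟦plug⟧ E Q)
    M⟦plug⟧ (op o A Ms)  Q = †-assoc _ _ (Args⟦plug⟧ A Q)
    M⟦plug⟧ (pairˡ E N)  Q = †-assoc _ _ (M⟦plug⟧ E Q)
    M⟦plug⟧ (pairʳ v E)  Q =
      trans (†-value _ (M⟦value⟧ v)) (†-assoc _ _ (M⟦plug⟧ E Q))
    M⟦plug⟧ (fst E)      Q = †-assoc _ _ (M⟦plug⟧ E Q)
    M⟦plug⟧ (snd E)      Q = †-assoc _ _ (M⟦plug⟧ E Q)
    M⟦plug⟧ (appˡ E N)   Q = †-assoc _ _ (M⟦plug⟧ E Q)
    M⟦plug⟧ (appʳ M E)   Q = trans (η-† _ _) (†-assoc _ _ (M⟦plug⟧ E Q))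

    Args⟦plug⟧ : ∀ {ρ bs} (A : ArgsECtx ρ bs) (Q : Program ρ) →
                 Args⟦ plug* A Q ⟧ [] ≡ (E*⟦ A ⟧ †) (M⟦ Q ⟧ [])
    Args⟦plug⟧ (hole E Ms) Q = †-assoc _ _ (M⟦plug⟧ E Q)
    Args⟦plug⟧ (skip c A)  Q = trans (η-† _ _) (†-assoc _ _ (Args⟦plug⟧ A Q))

  M⟦⟶⟧ : ∀ {σ} {M M′ : Program σ} → M ⟶ M′ → M⟦ M ⟧ [] ≡ M⟦ M′ ⟧ []
  M⟦⟶⟧ (within E {Q} {Q′} r) = begin
    M⟦ plug E Q ⟧ []         ≡⟨ M⟦plug⟧ E Q ⟩
    (E⟦ E ⟧ †) (M⟦ Q ⟧ [])   ≡⟨ cong (E⟦ E ⟧ †) (M⟦↦⟧ r) ⟩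
    (E⟦ E ⟧ †) (M⟦ Q′ ⟧ [])  ≡⟨ M⟦plug⟧ E Q′ ⟨
    M⟦ plug E Q′ ⟧ []        ∎

  M⟦plug-op⟧ : ∀ {ρ σ bs m} (ℰ : ECtx ρ σ) (o : OpSym bs m)
               (cs : All Const bs) (Ms : Vec (Program ρ) m) →
               M⟦ plug ℰ (op o (consts cs) Ms) ⟧ [] ≡
               ((λ i → M⟦ plug ℰ (Vec.lookup Ms i) ⟧ []) †)
                 (generic o (All.map C⟦_⟧ cs))
  M⟦plug-op⟧ ℰ o cs Ms =
    trans (M⟦plug⟧ ℰ _)
   (trans (†-assoc _ _ (M⟦op-consts⟧ o cs Ms []))
          (†-cong (λ i → sym (M⟦plug⟧ ℰ (Vec.lookup Ms i))) refl))

  -- The induction runs on the evaluation derivation, since `Op` itself is obtained from the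
  -- termination proof and is not structurally recursive in the program. In the `op` case both sides
  -- extend the same generic effect, so equality of the arms suffices.
  M⟦⇓⟧ : ∀ {σ} {M E : Program σ} → M ⇓ E → M⟦ M ⟧ [] ≡ M⟦ E ⟧ []
  M⟦⇓⟧ (value v)            = refl
  M⟦⇓⟧ (step r d)           = trans (M⟦⟶⟧ r) (M⟦⇓⟧ d)
  M⟦⇓⟧ (op ℰ o cs Ms Es ds) =
    trans (M⟦plug-op⟧ ℰ o cs Ms)
   (trans (†-cong (λ i → M⟦⇓⟧ (ds i)) refl)
          (sym (M⟦op-consts⟧ o cs Es [])))

theorem3p6 : Extensionality 0ℓ 0ℓ → (S : Signature) (𝒯 : Monad) (I : Interpretation S 𝒯) →
    let open Language S
        open Semantics S 𝒯 I
    in ∀ {σ} (N : Program σ) → M⟦ N ⟧ ≡ M⟦ Op N ⟧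
-- Denotations are functions of the environment, and a program has only the empty one.
theorem3p6 ext S 𝒯 I N = ext λ { [] → M⟦⇓⟧ (⇓-Op N) }
  where
  open Language S
  open Soundness ext S 𝒯 I
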